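{- Let $p>2$ be a prime number. Then: (i) $D(\Gamma(\mathbb{Z}_{2p}),x)=x^{p-1}+x(1+x)^{p-1}$; (ii) $D_t(\Gamma(\mathbb{Z}_{2p}),x)=x\left[(1+x)^{p-1}-1\right]$.
   Context: For a positive integer $n$, the zero-divisor graph $\Gamma(\mathbb{Z}_n)$ is the simple undirected loopless graph whose vertices are the nonzero zero-divisors of the ring $\mathbb{Z}_n$ of integers modulo $n$, two distinct vertices $u,v$ being adjacent if and only if $uv=0$ in $\mathbb{Z}_n$. For a finite simple graph $G$ with vertex set $V$, a set $S\subseteq V$ is a dominating set if every vertex of $V\setminus S$ is adjacent to at least one vertex of $S$; it is a total dominating set if every vertex of $V$ is adjacent to at least one vertex of $S$. Let $d(G,i)$ (resp. $d_t(G,i)$) be the number of dominating sets (resp. total dominating sets) of $G$ of cardinality $i$. The domination polynomial is $D(G,x)=\sum_{i=0}^{|V|}d(G,i)x^i$ and the total domination polynomial is $D_t(G,x)=\sum_{i=0}^{|V|}d_t(G,i)x^i$. -}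

module Defs where

open import Algebra.Bundles.Raw using (RawRing)
import Algebra.Definitions.RawSemiring as RawSemiringDefinitions
open import Data.Fin.Base using (Fin; toℕ)
open import Data.Fin.Properties using (any?; all?; nonZeroIndex) renaming (_≟_ to _≟ᶠ_)
open import Data.Fin.Subset using (Subset; inside; outside; _∈_; _∉_; _⊆_; ∣_∣)
open import Data.Fin.Subset.Properties using (_∈?_; _⊆?_)
open import Data.Integer.Base as ℤ using (ℤ; 0ℤ; 1ℤ; +_)
open import Data.List.Base using (List; []; _∷_; _++_; map; filter; length; applyUpTo)
open import Data.Nat.Base as ℕ using (ℕ; zero; suc)
open import Data.Nat.DivMod using (_mod_)
import Data.Nat.Properties as ℕₚ
open import Data.Product.Base using (∃; _×_; _,_; proj₁)
open import Data.Vec.Base as Vec using ()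
open import Function.Base using (_∘_)
open import Level using (0ℓ)
open import Relation.Binary.Core using (Rel)
open import Relation.Binary.Definitions using (Decidable; Symmetric; Irreflexive)
open import Relation.Binary.PropositionalEquality using (_≡_; _≢_; refl; sym; trans; cong)
open import Relation.Nullary.Decidable using (does; _×-dec_; _→-dec_; ¬?)
import Relation.Unary as Unary

private
  variable
    n : ℕ

-- The vertex set V is a subset of the ambient finite set Fin n; edges
-- only join elements of V.
record Graph (n : ℕ) : Set₁ where
  field
    V          : Subset n
    Adj        : Rel (Fin n) 0ℓ
    adj?       : Decidable Adj
    adj-sym    : Symmetric Adj
    adj-irrefl : Irreflexive _≡_ Adj
    adj⇒∈V     : ∀ {u v} → Adj u v → u ∈ V

module _ (G : Graph n) where
  open Graph G

  IsDominating : Subset n → Set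
  IsDominating S =
    S ⊆ V × (∀ v → v ∈ V → v ∉ S → ∃ λ u → u ∈ S × Adj v u)

  IsTotalDominating : Subset n → Set
  IsTotalDominating S =
    S ⊆ V × (∀ v → v ∈ V → ∃ λ u → u ∈ S × Adj v u)

  isDominating? : Unary.Decidable IsDominating
  isDominating? S = S ⊆? V ×-dec
    all? λ v → v ∈? V →-dec ¬? (v ∈? S) →-dec
      any? λ u → u ∈? S ×-dec adj? v u

  isTotalDominating? : Unary.Decidable IsTotalDominating
  isTotalDominating? S = S ⊆? V ×-dec
    all? λ v → v ∈? V →-dec any? λ u → u ∈? S ×-dec adj? v u

-- Every subset of Fin n, listed exactly once.
subsets : ∀ n → List (Subset n)
subsets zero    = Vec.[] ∷ []
subsets (suc n) = map (outside Vec.∷_) (subsets n) ++ map (inside Vec.∷_) (subsets n)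

-- d G i and dₜ G i count the (total) dominating sets S ⊆ V with ∣ S ∣ ≡ i.
d : Graph n → ℕ → ℕ
d G i = length (filter (λ S → isDominating? G S ×-dec ∣ S ∣ ℕₚ.≟ i) (subsets _))

dₜ : Graph n → ℕ → ℕ
dₜ G i = length (filter (λ S → isTotalDominating? G S ×-dec ∣ S ∣ ℕₚ.≟ i) (subsets _))

-- Integer polynomials in x:
-- a₀ ∷ a₁ ∷ … ∷ aₘ ∷ [] stands for a₀ + a₁ x + … + aₘ xᵐ. Trailing zeros
-- are allowed, so polynomials are compared by _≈ᴾ_, not by _≡_.
Poly : Set
Poly = List ℤ

coeff : Poly → ℕ → ℤ
coeff []      _       = 0ℤ
coeff (a ∷ f) zero    = a
coeff (a ∷ f) (suc k) = coeff f k

_≈ᴾ_ : Rel Poly 0ℓ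
f ≈ᴾ g = ∀ k → coeff f k ≡ coeff g k

_+ᴾ_ : Poly → Poly → Poly
[]      +ᴾ g       = g
(a ∷ f) +ᴾ []      = a ∷ f
(a ∷ f) +ᴾ (b ∷ g) = (a ℤ.+ b) ∷ (f +ᴾ g)

_*ᴾ_ : Poly → Poly → Poly
[]      *ᴾ g = []
(a ∷ f) *ᴾ g = map (a ℤ.*_) g +ᴾ (0ℤ ∷ (f *ᴾ g))

ℤ[x] : RawRing 0ℓ 0ℓ
ℤ[x] = record
  { Carrier = Poly
  ; _≈_     = _≈ᴾ_
  ; _+_     = _+ᴾ_
  ; _*_     = _*ᴾ_
  ; -_      = map (ℤ.-_)
  ; 0#      = []
  ; 1#      = 1ℤ ∷ []
  }

open RawRing ℤ[x] public using (_≈_; _+_; _*_; -_; 1#)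
open RawSemiringDefinitions (RawRing.rawSemiring ℤ[x]) public using (_^_)

infixl 6 _-_
_-_ : Poly → Poly → Poly
f - g = f + (- g)

x : Poly
x = 0ℤ ∷ 1ℤ ∷ []

-- The coefficient list of ∑_{i=0}^{|V|} d(G,i) xⁱ.
D : Graph n → Poly
D G = applyUpTo (λ i → + d G i) (suc ∣ Graph.V G ∣)

Dₜ : Graph n → Poly
Dₜ G = applyUpTo (λ i → + dₜ G i) (suc ∣ Graph.V G ∣)

-- Multiplication modulo n: ℤₙ is represented by Fin n (the residues 0, …, n-1). Having an element
-- of Fin n already makes n nonzero, so no such hypothesis is needed.
_·_ : Fin n → Fin n → Fin n
_·_ {n} a b = (toℕ a ℕ.* toℕ b) mod n
  where instance _ = nonZeroIndex a

IsZero : Fin n → Set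
IsZero a = toℕ a ≡ 0

isZero? : Unary.Decidable (IsZero {n})
isZero? a = toℕ a ℕₚ.≟ 0

IsNonzeroZeroDivisor : Fin n → Set
IsNonzeroZeroDivisor a =
  Unary.∁ IsZero a × ∃ λ b → Unary.∁ IsZero b × IsZero (a · b)

isNonzeroZeroDivisor? : Unary.Decidable (IsNonzeroZeroDivisor {n})
isNonzeroZeroDivisor? a =
  ¬? (isZero? a) ×-dec any? λ b → ¬? (isZero? b) ×-dec isZero? (a · b)

·-comm : (a b : Fin n) → a · b ≡ b · a
·-comm {n} a b = cong (λ m → m mod n) (ℕₚ.*-comm (toℕ a) (toℕ b))
  where instance _ = nonZeroIndex a

Γ : ∀ n → Graph n
Γ n = record
  { V          = V
  ; Adj        = λ u v → u ∈ V × v ∈ V × u ≢ v × IsZero (u · v)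
  ; adj?       = λ u v → u ∈? V ×-dec v ∈? V ×-dec ¬? (u ≟ᶠ v) ×-dec isZero? (u · v)
  ; adj-sym    = λ { {u} {v} (u∈V , v∈V , u≢v , uv≡0) →
                   v∈V , u∈V , u≢v ∘ sym , trans (cong toℕ (·-comm v u)) uv≡0 }
  ; adj-irrefl = λ { u≡v (_ , _ , u≢v , _) → u≢v u≡v }
  ; adj⇒∈V     = proj₁
  }
  where
  V : Subset n
  V = Vec.tabulate (does ∘ isNonzeroZeroDivisor?)

{-# OPTIONS --safe #-}

-- For an odd prime p the graph Γ(ℤ₂ₚ) is a star with p − 1 leaves: its centre is the residue p and
-- its leaves are the nonzero even residues. With centre c, vertex set V and leaves L = V − c, the
-- dominating sets are the S with {c} ⊆ S ⊆ V together with S = L, and the total dominating sets are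
-- the S with {c} ⊆ S ⊆ V other than {c}. All these families are made of intervals A ⊆ S ⊆ B of the
-- Boolean lattice, and such an interval has size generating function x^∣A∣ (1 + x)^(∣B∣ − ∣A∣).
module Submission where

open import Defs
open import Data.Nat using (ℕ; _<_; _∸_) renaming (_*_ to _*ℕ_)
open import Data.Nat.Primality using (Prime)
open import Data.Product using (_×_)

open import Data.Fin.Base using (Fin; zero; suc; toℕ; fromℕ<)
open import Data.Fin.Properties using (any?; nonZeroIndex; toℕ<n; toℕ-fromℕ<; toℕ-injective)
  renaming (_≟_ to _≟ᶠ_)
open import Data.Fin.Subset
  using (Subset; Side; inside; outside; _∈_; _∉_; _⊆_; _⊈_; ⁅_⁆)
  renaming (_-_ to _∖_; ∣_∣ to card)
open import Data.Fin.Subset.Properties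
open import Data.Integer.Base as ℤ using (ℤ; 0ℤ; 1ℤ; +_)
import Data.Integer.Properties as ℤₚ
open import Data.List.Base using ([]; _∷_; _++_; map; filter; length; applyUpTo)
open import Data.List.Properties using (length-++; filter-++; filter-≐; filter-none)
open import Data.List.Relation.Unary.All using (universal)
open import Data.Nat.Base as ℕ using (zero; suc; _≤_; z≤n; s≤s; z<s)
open import Data.Nat.Combinatorics using (_C_; nCk+nC[k+1]≡[n+1]C[k+1])
open import Data.Nat.Divisibility
open import Data.Nat.Primality
  using (euclidsLemma; prime[2]; prime⇒irreducible; prime⇒nonZero)
import Data.Nat.Properties as ℕₚ
open import Data.Product.Base using (∃; _,_; proj₁; proj₂)
open import Data.Sum.Base using (_⊎_; inj₁; inj₂; [_,_]′)
open import Data.Vec.Base as Vec using ([]; _∷_; here; there)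
open import Data.Vec.Properties using ([]=⇒lookup; lookup⇒[]=; lookup∘tabulate)
open import Function.Base using (_∘_)
open import Function.Bundles using (_⇔_; mk⇔; Equivalence)
open import Relation.Binary.PropositionalEquality
open import Relation.Nullary using (¬_; Dec; yes; no; contradiction)
open import Relation.Nullary.Decidable using (does; _×-dec_; ¬?; dec-true)
import Relation.Unary as Unary

open Equivalence using (to; from)
open ≡-Reasoning

private
  variable
    n : ℕ

-- Coefficients of polynomials

coeff-+ : ∀ f g k → coeff (f + g) k ≡ coeff f k ℤ.+ coeff g k
coeff-+ []      g       k       = sym (ℤₚ.+-identityˡ _)
coeff-+ (a ∷ f) []      k       = sym (ℤₚ.+-identityʳ _)
coeff-+ (a ∷ f) (b ∷ g) zero    = refl
coeff-+ (a ∷ f) (b ∷ g) (suc k) = coeff-+ f g k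

coeff-neg : ∀ f k → coeff (- f) k ≡ ℤ.- coeff f k
coeff-neg []      k       = refl
coeff-neg (a ∷ f) zero    = refl
coeff-neg (a ∷ f) (suc k) = coeff-neg f k

coeff-scale : ∀ a f k → coeff (map (a ℤ.*_) f) k ≡ a ℤ.* coeff f k
coeff-scale a []      k       = sym (ℤₚ.*-zeroʳ a)
coeff-scale a (b ∷ f) zero    = refl
coeff-scale a (b ∷ f) (suc k) = coeff-scale a f k

coeff-∷*-zero : ∀ a f g → coeff ((a ∷ f) * g) 0 ≡ a ℤ.* coeff g 0
coeff-∷*-zero a f g = begin
  coeff ((a ∷ f) * g) 0               ≡⟨ coeff-+ (map (a ℤ.*_) g) _ 0 ⟩
  coeff (map (a ℤ.*_) g) 0 ℤ.+ 0ℤ     ≡⟨ ℤₚ.+-identityʳ _ ⟩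
  coeff (map (a ℤ.*_) g) 0            ≡⟨ coeff-scale a g 0 ⟩
  a ℤ.* coeff g 0                     ∎

coeff-∷*-suc : ∀ a f g k →
  coeff ((a ∷ f) * g) (suc k) ≡ a ℤ.* coeff g (suc k) ℤ.+ coeff (f * g) k
coeff-∷*-suc a f g k = trans (coeff-+ (map (a ℤ.*_) g) _ (suc k))
  (cong (ℤ._+ coeff (f * g) k) (coeff-scale a g (suc k)))

coeff-1#* : ∀ f k → coeff (1# * f) k ≡ coeff f k
coeff-1#* f zero    = trans (coeff-∷*-zero 1ℤ [] f) (ℤₚ.*-identityˡ _)
coeff-1#* f (suc k) = trans (coeff-∷*-suc 1ℤ [] f k)
  (trans (ℤₚ.+-identityʳ _) (ℤₚ.*-identityˡ _))

coeff-x*-suc : ∀ f k → coeff (x * f) (suc k) ≡ coeff f k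
coeff-x*-suc f k = trans (coeff-∷*-suc 0ℤ 1# f k)
  (trans (ℤₚ.+-identityˡ _) (coeff-1#* f k))

coeff-[1+x]*-zero : ∀ f → coeff ((1# + x) * f) 0 ≡ coeff f 0
coeff-[1+x]*-zero f = trans (coeff-∷*-zero 1ℤ 1# f) (ℤₚ.*-identityˡ _)

coeff-[1+x]*-suc : ∀ f k →
  coeff ((1# + x) * f) (suc k) ≡ coeff f (suc k) ℤ.+ coeff f k
coeff-[1+x]*-suc f k = trans (coeff-∷*-suc 1ℤ 1# f k)
  (cong₂ ℤ._+_ (ℤₚ.*-identityˡ (coeff f (suc k))) (coeff-1#* f k))

-- `coeff` is `0ℤ` past the end of a list, so truncating at `m` loses nothing once `f` vanishes from
-- `m` on.
coeff-applyUpTo : ∀ (f : ℕ → ℤ) m → (∀ k → m ≤ k → f k ≡ 0ℤ) →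
  ∀ k → coeff (applyUpTo f m) k ≡ f k
coeff-applyUpTo f zero    f≡0 k       = sym (f≡0 k z≤n)
coeff-applyUpTo f (suc m) f≡0 zero    = refl
coeff-applyUpTo f (suc m) f≡0 (suc k) =
  coeff-applyUpTo (f ∘ suc) m (λ j m≤j → f≡0 (suc j) (s≤s m≤j)) k

-- The coefficient of xᵏ in xᵃ (1 + x)ᵇ.
shiftedBinomial : ℕ → ℕ → ℕ → ℕ
shiftedBinomial zero    b k       = b C k
shiftedBinomial (suc a) b zero    = 0
shiftedBinomial (suc a) b (suc k) = shiftedBinomial a b k

shiftedBinomial-zero : ∀ a b → shiftedBinomial a (suc b) 0 ≡ shiftedBinomial a b 0
shiftedBinomial-zero zero    b = refl
shiftedBinomial-zero (suc a) b = refl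

-- Pascal's rule: the effect of one more factor `1 + x`, shifted by `a`.
shiftedBinomial-suc : ∀ a b k →
  shiftedBinomial a (suc b) (suc k) ≡ shiftedBinomial a b (suc k) ℕ.+ shiftedBinomial a b k
shiftedBinomial-suc zero    b k       =
  trans (sym (nCk+nC[k+1]≡[n+1]C[k+1] b k)) (ℕₚ.+-comm (b C k) (b C suc k))
shiftedBinomial-suc (suc a) b zero    =
  trans (shiftedBinomial-zero a b) (sym (ℕₚ.+-identityʳ _))
shiftedBinomial-suc (suc a) b (suc k) = shiftedBinomial-suc a b k

coeff-1# : ∀ k → coeff 1# k ≡ + (0 C k)
coeff-1# zero    = refl
coeff-1# (suc k) = refl

coeff-x^ : ∀ a k → coeff (x ^ a) k ≡ + shiftedBinomial a 0 k
coeff-x^ zero    k       = coeff-1# k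
coeff-x^ (suc a) zero    = coeff-∷*-zero 0ℤ 1# (x ^ a)
coeff-x^ (suc a) (suc k) = trans (coeff-x*-suc (x ^ a) k) (coeff-x^ a k)

coeff-[1+x]^ : ∀ b k → coeff ((1# + x) ^ b) k ≡ + (b C k)
coeff-[1+x]^ zero    k       = coeff-1# k
coeff-[1+x]^ (suc b) zero    =
  trans (coeff-[1+x]*-zero ((1# + x) ^ b)) (coeff-[1+x]^ b zero)
coeff-[1+x]^ (suc b) (suc k) = begin
  coeff ((1# + x) ^ suc b) (suc k)
    ≡⟨ coeff-[1+x]*-suc ((1# + x) ^ b) k ⟩
  coeff ((1# + x) ^ b) (suc k) ℤ.+ coeff ((1# + x) ^ b) k
    ≡⟨ cong₂ ℤ._+_ (coeff-[1+x]^ b (suc k)) (coeff-[1+x]^ b k) ⟩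
  + (b C suc k ℕ.+ b C k)
    ≡⟨ cong +_ (shiftedBinomial-suc 0 b k) ⟨
  + (suc b C suc k) ∎

coeff-x*[1+x]^ : ∀ b k → coeff (x * (1# + x) ^ b) k ≡ + shiftedBinomial 1 b k
coeff-x*[1+x]^ b zero    = coeff-∷*-zero 0ℤ 1# ((1# + x) ^ b)
coeff-x*[1+x]^ b (suc k) = trans (coeff-x*-suc ((1# + x) ^ b) k) (coeff-[1+x]^ b k)

-- Counting subsets

module _ {A : Set} {P Q R : A → Set}
  (P? : Unary.Decidable P) (Q? : Unary.Decidable Q) (R? : Unary.Decidable R)
  (P⇔Q⊎R : ∀ {a} → P a ⇔ (Q a ⊎ R a)) (disjoint : ∀ {a} → Q a → ¬ R a) where

  -- Serves in two ways: for dominating sets the unknown family is `P`; for total dominating sets it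
  -- is the summand `Q`, found by subtraction.
  length-filter-⊎ : ∀ as →
    length (filter P? as) ≡ length (filter Q? as) ℕ.+ length (filter R? as)
  length-filter-⊎ [] = refl
  length-filter-⊎ (a ∷ as) with P? a | Q? a | R? a
  ... | _      | yes qa | yes ra = contradiction ra (disjoint qa)
  ... | yes _  | yes _  | no _   = cong suc (length-filter-⊎ as)
  ... | yes _  | no _   | yes _  = trans (cong suc (length-filter-⊎ as)) (sym (ℕₚ.+-suc _ _))
  ... | no _   | no _   | no _   = length-filter-⊎ as
  ... | yes pa | no ¬qa | no ¬ra = contradiction (to P⇔Q⊎R pa) [ ¬qa , ¬ra ]′
  ... | no ¬pa | yes qa | no _   = contradiction (from P⇔Q⊎R (inj₁ qa)) ¬pa
  ... | no ¬pa | no _   | yes ra = contradiction (from P⇔Q⊎R (inj₂ ra)) ¬pa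

length-filter-map : ∀ {A B : Set} {P : B → Set} (P? : Unary.Decidable P) (f : A → B) as →
  length (filter P? (map f as)) ≡ length (filter (P? ∘ f) as)
length-filter-map P? f []       = refl
length-filter-map P? f (a ∷ as) with P? (f a)
... | yes _ = cong suc (length-filter-map P? f as)
... | no _  = length-filter-map P? f as

count : {P : Subset n → Set} → Unary.Decidable P → ℕ
count {n} P? = length (filter P? (subsets n))

count-∷ : {P : Subset (suc n) → Set} (P? : Unary.Decidable P) →
  count P? ≡ count (P? ∘ (outside ∷_)) ℕ.+ count (P? ∘ (inside ∷_))
count-∷ {n} P? = begin
  length (filter P? (map (outside ∷_) Ss ++ map (inside ∷_) Ss))
    ≡⟨ cong length (filter-++ P? (map (outside ∷_) Ss) _) ⟩
  length (filter P? (map (outside ∷_) Ss) ++ filter P? (map (inside ∷_) Ss))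
    ≡⟨ length-++ (filter P? (map (outside ∷_) Ss)) ⟩
  length (filter P? (map (outside ∷_) Ss)) ℕ.+ length (filter P? (map (inside ∷_) Ss))
    ≡⟨ cong₂ ℕ._+_ (length-filter-map P? _ Ss) (length-filter-map P? _ Ss) ⟩
  count (P? ∘ (outside ∷_)) ℕ.+ count (P? ∘ (inside ∷_)) ∎
  where Ss = subsets n

count-≐ : {P Q : Subset n → Set} (P? : Unary.Decidable P) (Q? : Unary.Decidable Q) →
  (∀ {S} → P S → Q S) → (∀ {S} → Q S → P S) → count P? ≡ count Q?
count-≐ {n} P? Q? P⇒Q Q⇒P = cong length (filter-≐ P? Q? (P⇒Q , Q⇒P) (subsets n))

count-none : {P : Subset n → Set} (P? : Unary.Decidable P) → (∀ S → ¬ P S) → count P? ≡ 0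
count-none {n} P? ¬P = cong length (filter-none P? (universal ¬P (subsets n)))

-- Intervals of the Boolean lattice, counted by size.

Interval : Subset n → Subset n → Subset n → Set
Interval A B S = A ⊆ S × S ⊆ B

interval? : (A B : Subset n) → Unary.Decidable (Interval A B)
interval? A B S = A ⊆? S ×-dec S ⊆? B

-- Shaped so that `d G k` and `dₜ G k` are by definition counts of `ofSize?`.
OfSize : (Subset n → Set) → ℕ → Subset n → Set
OfSize P k S = P S × card S ≡ k

ofSize? : {P : Subset n → Set} → Unary.Decidable P → ∀ k → Unary.Decidable (OfSize P k)
ofSize? P? k S = P? S ×-dec card S ℕₚ.≟ k

in⊈out : {p q : Subset n} → inside ∷ p ⊈ outside ∷ q
in⊈out p⊆q with () ← p⊆q here

-- Position by position: a position outside `B` contributes a factor 1, a position in `A` a factor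
-- `x`, and a position in `B` but not in `A` is free and contributes `1 + x`.
count-interval : (A B : Subset n) → A ⊆ B → ∀ k →
  count (ofSize? (interval? A B) k) ≡ shiftedBinomial (card A) (card B ∸ card A) k
count-interval [] [] A⊆B zero    = refl
count-interval [] [] A⊆B (suc k) = refl
count-interval (inside ∷ A) (outside ∷ B) A⊆B k with () ← A⊆B here
count-interval (outside ∷ A) (outside ∷ B) A⊆B k = begin
  count I?
    ≡⟨ count-∷ I? ⟩
  count (I? ∘ (outside ∷_)) ℕ.+ count (I? ∘ (inside ∷_))
    ≡⟨ cong₂ ℕ._+_
         (count-≐ (I? ∘ (outside ∷_)) (ofSize? (interval? A B) k)
           (λ ((l , u) , s) → (drop-∷-⊆ l , drop-∷-⊆ u) , s)
           (λ ((l , u) , s) → (out⊆ l , out⊆ u) , s))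
         (count-none (I? ∘ (inside ∷_)) (λ S ((_ , u) , _) → in⊈out u)) ⟩
  count (ofSize? (interval? A B) k) ℕ.+ 0
    ≡⟨ ℕₚ.+-identityʳ _ ⟩
  count (ofSize? (interval? A B) k)
    ≡⟨ count-interval A B (drop-∷-⊆ A⊆B) k ⟩
  shiftedBinomial (card A) (card B ∸ card A) k ∎
  where I? = ofSize? (interval? (outside ∷ A) (outside ∷ B)) k
count-interval (outside ∷ A) (inside ∷ B) A⊆B k = begin
  count I?
    ≡⟨ count-∷ I? ⟩
  count (I? ∘ (outside ∷_)) ℕ.+ count (I? ∘ (inside ∷_))
    ≡⟨ cong (ℕ._+ count (I? ∘ (inside ∷_)))
         (trans (count-≐ (I? ∘ (outside ∷_)) (ofSize? (interval? A B) k)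
                  (λ ((l , u) , s) → (drop-∷-⊆ l , drop-∷-⊆ u) , s)
                  (λ ((l , u) , s) → (out⊆ l , out⊆ u) , s))
                (count-interval A B A′⊆B′ k)) ⟩
  shiftedBinomial (card A) (card B ∸ card A) k ℕ.+ count (I? ∘ (inside ∷_))
    ≡⟨ with-head k ⟩
  shiftedBinomial (card A) (suc (card B ∸ card A)) k
    -- Truncated subtraction commutes with `suc` here because `card A ≤ card B`.
    ≡⟨ cong (λ b → shiftedBinomial (card A) b k) (ℕₚ.+-∸-assoc 1 (p⊆q⇒∣p∣≤∣q∣ A′⊆B′)) ⟨
  shiftedBinomial (card A) (suc (card B) ∸ card A) k ∎
  where
  I? = ofSize? (interval? (outside ∷ A) (inside ∷ B)) k
  A′⊆B′ = drop-∷-⊆ A⊆B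
  -- Sets containing the head spend one unit of size on it: there are none for `k = 0`, and for
  -- `suc k` the tail has size `k`.
  with-head : ∀ k →
    shiftedBinomial (card A) (card B ∸ card A) k ℕ.+
      count (ofSize? (interval? (outside ∷ A) (inside ∷ B)) k ∘ (inside ∷_))
    ≡ shiftedBinomial (card A) (suc (card B ∸ card A)) k
  with-head zero =
    trans (cong (shiftedBinomial (card A) (card B ∸ card A) 0 ℕ.+_)
            (count-none (ofSize? (interval? (outside ∷ A) (inside ∷ B)) 0 ∘ (inside ∷_))
              λ { S (_ , ()) }))
      (trans (ℕₚ.+-identityʳ _) (sym (shiftedBinomial-zero (card A) _)))
  with-head (suc k) =
    trans (cong (shiftedBinomial (card A) _ (suc k) ℕ.+_)
            (trans (count-≐ _ (ofSize? (interval? A B) k)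
                     (λ ((l , u) , s) → (drop-∷-⊆ l , drop-∷-⊆ u) , ℕₚ.suc-injective s)
                     (λ ((l , u) , s) → (out⊆ l , in⊆in u) , cong suc s))
                   (count-interval A B A′⊆B′ k)))
      (sym (shiftedBinomial-suc (card A) _ k))
count-interval (inside ∷ A) (inside ∷ B) A⊆B k = begin
  count I?
    ≡⟨ count-∷ I? ⟩
  count (I? ∘ (outside ∷_)) ℕ.+ count (I? ∘ (inside ∷_))
    ≡⟨ cong (ℕ._+ count (I? ∘ (inside ∷_)))
         (count-none (I? ∘ (outside ∷_)) (λ S ((l , _) , _) → in⊈out l)) ⟩
  count (I? ∘ (inside ∷_))
    ≡⟨ with-head k ⟩
  shiftedBinomial (suc (card A)) (card B ∸ card A) k ∎
  where
  I? = ofSize? (interval? (inside ∷ A) (inside ∷ B)) k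
  with-head : ∀ k →
    count (ofSize? (interval? (inside ∷ A) (inside ∷ B)) k ∘ (inside ∷_))
    ≡ shiftedBinomial (suc (card A)) (card B ∸ card A) k
  with-head zero    =
    count-none (ofSize? (interval? (inside ∷ A) (inside ∷ B)) 0 ∘ (inside ∷_)) λ { S (_ , ()) }
  with-head (suc k) =
    trans (count-≐ _ (ofSize? (interval? A B) k)
            (λ ((l , u) , s) → (drop-∷-⊆ l , drop-∷-⊆ u) , ℕₚ.suc-injective s)
            (λ ((l , u) , s) → (in⊆in l , in⊆in u) , cong suc s))
      (count-interval A B (drop-∷-⊆ A⊆B) k)

x∉p-x : ∀ (p : Subset n) v → v ∉ p ∖ v
x∉p-x (_ ∷ p) zero    ()
x∉p-x (_ ∷ p) (suc v) (there v∈) = x∉p-x p v v∈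

x∈p⇒∣p∣≡1+∣p-x∣ : {p : Subset n} {v : Fin n} → v ∈ p → card p ≡ suc (card (p ∖ v))
x∈p⇒∣p∣≡1+∣p-x∣ {p = _ ∷ p}       here       = cong (suc ∘ card) (sym (p─⊥≡p p))
x∈p⇒∣p∣≡1+∣p-x∣ {p = inside ∷ _}  (there v∈) = cong suc (x∈p⇒∣p∣≡1+∣p-x∣ v∈)
x∈p⇒∣p∣≡1+∣p-x∣ {p = outside ∷ _} (there v∈) = x∈p⇒∣p∣≡1+∣p-x∣ v∈

⁅x⁆⊆p : {p : Subset n} {v : Fin n} → v ∈ p → ⁅ v ⁆ ⊆ p
⁅x⁆⊆p {p = p} {v} v∈p u∈ = subst (_∈ p) (sym (x∈⁅y⁆⇒x≡y v u∈)) v∈p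

-- Domination polynomials of graphs

module _ (G : Graph n) where
  open Graph G

  -- Dominating sets lie in `V`, so none is larger than the degree at which `D G` stops.
  coeff-D : ∀ k → coeff (D G) k ≡ + d G k
  coeff-D = coeff-applyUpTo (λ i → + d G i) (suc (card V)) λ k ∣V∣<k →
    cong +_ (count-none (ofSize? (isDominating? G) k) λ { S ((S⊆V , _) , refl) →
      ℕₚ.<⇒≱ ∣V∣<k (p⊆q⇒∣p∣≤∣q∣ S⊆V) })

  coeff-Dₜ : ∀ k → coeff (Dₜ G) k ≡ + dₜ G k
  coeff-Dₜ = coeff-applyUpTo (λ i → + dₜ G i) (suc (card V)) λ k ∣V∣<k →
    cong +_ (count-none (ofSize? (isTotalDominating? G) k) λ { S ((S⊆V , _) , refl) →
      ℕₚ.<⇒≱ ∣V∣<k (p⊆q⇒∣p∣≤∣q∣ S⊆V) })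

-- Dominating and total dominating sets of a star.

record IsStar (G : Graph n) (c : Fin n) : Set where
  open Graph G
  field
    centre∈V : c ∈ V
    leaf     : ∃ λ ℓ → ℓ ∈ V × ℓ ≢ c
    leaf-adj : ∀ {v} → v ∈ V → v ≢ c → Adj v c
    adj-leaf : ∀ {u v} → u ≢ c → Adj u v → v ≡ c

module _ (G : Graph n) (c : Fin n) (star : IsStar G c) where
  open Graph G
  open IsStar star

  leaves : Subset n
  leaves = V ∖ c

  leaves⊆V : leaves ⊆ V
  leaves⊆V = p─q⊆p V ⁅ c ⁆

  ∈leaves⇒≢c : ∀ {v} → v ∈ leaves → v ≢ c
  ∈leaves⇒≢c v∈ refl = x∉p-x V c v∈

  -- If `c ∉ S`, a leaf outside `S` would have no neighbour in `S`, its only neighbour being `c`; so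
  -- `S` holds every leaf. Conversely `c` dominates all leaves, and `leaf` supplies one that
  -- dominates `c`.
  dominating⇔ : ∀ {S} → IsDominating G S ⇔ (Interval ⁅ c ⁆ V S ⊎ Interval leaves leaves S)
  dominating⇔ {S} = mk⇔ ⇒ ⇐
    where
    ⇒ : IsDominating G S → Interval ⁅ c ⁆ V S ⊎ Interval leaves leaves S
    ⇒ (S⊆V , dom) with c ∈? S
    ... | yes c∈S = inj₁ (⁅x⁆⊆p c∈S , S⊆V)
    ... | no  c∉S = inj₂ (leaves⊆S , λ v∈S → x∈p∧x≢y⇒x∈p-y (S⊆V v∈S) λ { refl → c∉S v∈S })
      where
      leaves⊆S : leaves ⊆ S
      leaves⊆S {v} v∈leaves with v ∈? S
      ... | yes v∈S = v∈S
      ... | no  v∉S with dom v (leaves⊆V v∈leaves) v∉S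
      ...   | u , u∈S , v~u = contradiction
              (subst (_∈ S) (adj-leaf (∈leaves⇒≢c v∈leaves) v~u) u∈S) c∉S
    ⇐ : Interval ⁅ c ⁆ V S ⊎ Interval leaves leaves S → IsDominating G S
    ⇐ (inj₁ (c⊆S , S⊆V)) = S⊆V , λ v v∈V v∉S →
      c , c⊆S (x∈⁅x⁆ c) , leaf-adj v∈V λ { refl → v∉S (c⊆S (x∈⁅x⁆ c)) }
    ⇐ (inj₂ (L⊆S , S⊆L)) = leaves⊆V ∘ S⊆L , dom
      where
      dom : ∀ v → v ∈ V → v ∉ S → ∃ λ u → u ∈ S × Adj v u
      dom v v∈V v∉S with v ≟ᶠ c | leaf
      ... | yes refl | ℓ , ℓ∈V , ℓ≢c =
            ℓ , L⊆S (x∈p∧x≢y⇒x∈p-y ℓ∈V ℓ≢c) , adj-sym (leaf-adj ℓ∈V ℓ≢c)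
      ... | no v≢c   | _ = contradiction (L⊆S (x∈p∧x≢y⇒x∈p-y v∈V v≢c)) v∉S

  -- A total dominating set contains `c`, the only neighbour of a leaf. Conversely, when `c ∈ S`,
  -- all leaves are dominated by `c`, and `c` is dominated as soon as `S` has an element other than
  -- `c`.
  centred⇔ : ∀ {S} → Interval ⁅ c ⁆ V S ⇔ (IsTotalDominating G S ⊎ Interval ⁅ c ⁆ ⁅ c ⁆ S)
  centred⇔ {S} = mk⇔ ⇒ ⇐
    where
    ⇒ : Interval ⁅ c ⁆ V S → IsTotalDominating G S ⊎ Interval ⁅ c ⁆ ⁅ c ⁆ S
    ⇒ (c⊆S , S⊆V) with any? (λ ℓ → ℓ ∈? S ×-dec ¬? (ℓ ≟ᶠ c))
    ... | yes (ℓ , ℓ∈S , ℓ≢c) = inj₁ (S⊆V , dom)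
      where
      dom : ∀ v → v ∈ V → ∃ λ u → u ∈ S × Adj v u
      dom v v∈V with v ≟ᶠ c
      ... | yes refl = ℓ , ℓ∈S , adj-sym (leaf-adj (S⊆V ℓ∈S) ℓ≢c)
      ... | no v≢c   = c , c⊆S (x∈⁅x⁆ c) , leaf-adj v∈V v≢c
    ... | no ∄ℓ = inj₂ (c⊆S , S⊆c)
      where
      S⊆c : S ⊆ ⁅ c ⁆
      S⊆c {v} v∈S with v ≟ᶠ c
      ... | yes refl = x∈⁅x⁆ c
      ... | no v≢c   = contradiction (v , v∈S , v≢c) ∄ℓ
    ⇐ : IsTotalDominating G S ⊎ Interval ⁅ c ⁆ ⁅ c ⁆ S → Interval ⁅ c ⁆ V S
    ⇐ (inj₁ (S⊆V , dom)) with leaf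
    ... | ℓ , ℓ∈V , ℓ≢c with dom ℓ ℓ∈V
    ...   | u , u∈S , ℓ~u = ⁅x⁆⊆p (subst (_∈ S) (adj-leaf ℓ≢c ℓ~u) u∈S) , S⊆V
    ⇐ (inj₂ (c⊆S , S⊆c)) = c⊆S , ⁅x⁆⊆p centre∈V ∘ S⊆c

  module _ {m : ℕ} (∣V∣≡1+m : card V ≡ suc m) where

    count-centred : ∀ k → count (ofSize? (interval? ⁅ c ⁆ V) k) ≡ shiftedBinomial 1 m k
    count-centred k = trans (count-interval ⁅ c ⁆ V (⁅x⁆⊆p centre∈V) k)
      (cong₂ (λ a b → shiftedBinomial a (b ∸ a) k) (∣⁅x⁆∣≡1 c) ∣V∣≡1+m)

    -- The interval from `A` to `A` holds the single set `A`, so its generating function is a pure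
    -- power of `x`.
    count-degenerate : ∀ (A : Subset n) k →
      count (ofSize? (interval? A A) k) ≡ shiftedBinomial (card A) 0 k
    count-degenerate A k = trans (count-interval A A ⊆-refl k)
      (cong (λ b → shiftedBinomial (card A) b k) (ℕₚ.n∸n≡0 (card A)))

    ∣leaves∣≡m : card leaves ≡ m
    ∣leaves∣≡m = ℕₚ.suc-injective (trans (sym (x∈p⇒∣p∣≡1+∣p-x∣ centre∈V)) ∣V∣≡1+m)

    d-star : ∀ k → d G k ≡ shiftedBinomial 1 m k ℕ.+ shiftedBinomial m 0 k
    d-star k = begin
      d G k
        ≡⟨ length-filter-⊎ (ofSize? (isDominating? G) k)
             (ofSize? (interval? ⁅ c ⁆ V) k) (ofSize? (interval? leaves leaves) k)
             (mk⇔ (λ (dom , s) → [ (λ i → inj₁ (i , s)) , (λ i → inj₂ (i , s)) ]′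
                                   (to dominating⇔ dom))
                  [ (λ (i , s) → from dominating⇔ (inj₁ i) , s)
                  , (λ (i , s) → from dominating⇔ (inj₂ i) , s) ]′)
             (λ ((c⊆S , _) , _) ((_ , S⊆L) , _) → x∉p-x V c (S⊆L (c⊆S (x∈⁅x⁆ c))))
             (subsets n) ⟩
      count (ofSize? (interval? ⁅ c ⁆ V) k) ℕ.+ count (ofSize? (interval? leaves leaves) k)
        ≡⟨ cong₂ ℕ._+_ (count-centred k) (count-degenerate leaves k) ⟩
      shiftedBinomial 1 m k ℕ.+ shiftedBinomial (card leaves) 0 k
        ≡⟨ cong (λ a → shiftedBinomial 1 m k ℕ.+ shiftedBinomial a 0 k) ∣leaves∣≡m ⟩
      shiftedBinomial 1 m k ℕ.+ shiftedBinomial m 0 k ∎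

    -- Kept additive in ℕ; the singleton `⁅ c ⁆` is subtracted only later, in ℤ.
    dₜ-star : ∀ k → shiftedBinomial 1 m k ≡ dₜ G k ℕ.+ shiftedBinomial 1 0 k
    dₜ-star k = begin
      shiftedBinomial 1 m k
        ≡⟨ count-centred k ⟨
      count (ofSize? (interval? ⁅ c ⁆ V) k)
        ≡⟨ length-filter-⊎ (ofSize? (interval? ⁅ c ⁆ V) k)
             (ofSize? (isTotalDominating? G) k) (ofSize? (interval? ⁅ c ⁆ ⁅ c ⁆) k)
             (mk⇔ (λ (i , s) → [ (λ dom → inj₁ (dom , s)) , (λ j → inj₂ (j , s)) ]′
                                 (to centred⇔ i))
                  [ (λ (dom , s) → from centred⇔ (inj₁ dom) , s)
                  , (λ (j , s) → from centred⇔ (inj₂ j) , s) ]′)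
             (λ ((_ , dom) , _) ((_ , S⊆c) , _) → centre-alone dom S⊆c)
             (subsets n) ⟩
      dₜ G k ℕ.+ count (ofSize? (interval? ⁅ c ⁆ ⁅ c ⁆) k)
        ≡⟨ cong (dₜ G k ℕ.+_) (count-degenerate ⁅ c ⁆ k) ⟩
      dₜ G k ℕ.+ shiftedBinomial (card ⁅ c ⁆) 0 k
        ≡⟨ cong (λ a → dₜ G k ℕ.+ shiftedBinomial a 0 k) (∣⁅x⁆∣≡1 c) ⟩
      dₜ G k ℕ.+ shiftedBinomial 1 0 k ∎
      where
      -- The neighbour of `c` found in `S` would be `c` itself, against irreflexivity.
      centre-alone : ∀ {S} → (∀ v → v ∈ V → ∃ λ u → u ∈ S × Adj v u) → S ⊈ ⁅ c ⁆
      centre-alone dom S⊆c with dom c centre∈V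
      ... | u , u∈S , c~u = adj-irrefl (sym (x∈⁅y⁆⇒x≡y c (S⊆c u∈S))) c~u

    D-star : D G ≈ x ^ m + x * (1# + x) ^ m
    D-star k = begin
      coeff (D G) k
        ≡⟨ coeff-D G k ⟩
      + d G k
        ≡⟨ cong +_ (trans (d-star k) (ℕₚ.+-comm (shiftedBinomial 1 m k) _)) ⟩
      + shiftedBinomial m 0 k ℤ.+ + shiftedBinomial 1 m k
        ≡⟨ cong₂ ℤ._+_ (coeff-x^ m k) (coeff-x*[1+x]^ m k) ⟨
      coeff (x ^ m) k ℤ.+ coeff (x * (1# + x) ^ m) k
        ≡⟨ coeff-+ (x ^ m) _ k ⟨
      coeff (x ^ m + x * (1# + x) ^ m) k ∎

    Dₜ-star : Dₜ G ≈ x * ((1# + x) ^ m - 1#)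
    Dₜ-star zero = begin
      coeff (Dₜ G) 0                        ≡⟨ coeff-Dₜ G 0 ⟩
      -- Both shifted binomials in `dₜ-star 0` reduce to 0.
      + dₜ G 0                              ≡⟨ cong +_ (ℕₚ.m+n≡0⇒m≡0 (dₜ G 0) {0} (sym (dₜ-star 0))) ⟩
      0ℤ                                    ≡⟨ coeff-∷*-zero 0ℤ 1# ((1# + x) ^ m - 1#) ⟨
      coeff (x * ((1# + x) ^ m - 1#)) 0     ∎
    Dₜ-star (suc k) = begin
      coeff (Dₜ G) (suc k)
        ≡⟨ coeff-Dₜ G (suc k) ⟩
      + dₜ G (suc k)
        ≡⟨ ℤₚ.+-identityʳ _ ⟨
      + dₜ G (suc k) ℤ.+ 0ℤ
        -- `0 C k` is the coefficient of `1#` at `k`; it is added and removed so that `dₜ-star`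
        -- applies to the sum.
        ≡⟨ cong (λ z → + dₜ G (suc k) ℤ.+ z) (ℤₚ.+-inverseʳ (+ (0 C k))) ⟨
      + dₜ G (suc k) ℤ.+ (+ (0 C k) ℤ.- + (0 C k))
        ≡⟨ ℤₚ.+-assoc (+ dₜ G (suc k)) (+ (0 C k)) (ℤ.- + (0 C k)) ⟨
      + (dₜ G (suc k) ℕ.+ 0 C k) ℤ.- + (0 C k)
        -- At `suc k` the two shifted binomials of `dₜ-star` reduce to `m C k` and `0 C k`.
        ≡⟨ cong (λ b → + b ℤ.- + (0 C k)) (dₜ-star (suc k)) ⟨
      + (m C k) ℤ.- + (0 C k)
        ≡⟨ cong₂ ℤ._-_ (coeff-[1+x]^ m k) (coeff-1# k) ⟨
      coeff ((1# + x) ^ m) k ℤ.- coeff 1# k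
        ≡⟨ cong (λ z → coeff ((1# + x) ^ m) k ℤ.+ z) (coeff-neg 1# k) ⟨
      coeff ((1# + x) ^ m) k ℤ.+ coeff (- 1#) k
        ≡⟨ coeff-+ ((1# + x) ^ m) (- 1#) k ⟨
      coeff ((1# + x) ^ m - 1#) k
        ≡⟨ coeff-x*-suc ((1# + x) ^ m - 1#) k ⟨
      coeff (x * ((1# + x) ^ m - 1#)) (suc k) ∎

-- The zero-divisor graph of ℤ₂ₚ

-- Parity laid out by structural recursion, so that cardinalities follow by induction; the `Side`
-- tells whether position 0 belongs.
alternate : Side → ∀ n → Subset n
alternate s       zero    = []
alternate inside  (suc n) = inside ∷ alternate outside n
alternate outside (suc n) = outside ∷ alternate inside n

∈alternate-inside  : (i : Fin n) → i ∈ alternate inside n ⇔ 2 ∣ toℕ i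
∈alternate-outside : (i : Fin n) → i ∈ alternate outside n ⇔ 2 ∣ suc (toℕ i)

∈alternate-inside zero    = mk⇔ (λ _ → 2 ∣0) (λ _ → here)
∈alternate-inside (suc i) =
  mk⇔ (λ { (there i∈) → to (∈alternate-outside i) i∈ }) (there ∘ from (∈alternate-outside i))

∈alternate-outside zero    = mk⇔ (λ ()) (λ 2∣1 → contradiction (∣⇒≤ 2∣1) λ { (s≤s ()) })
∈alternate-outside (suc i) =
  mk⇔ (λ { (there i∈) → ∣m∣n⇒∣m+n ∣-refl (to (∈alternate-inside i) i∈) })
      (λ 2∣2+i → there (from (∈alternate-inside i) (∣m+n∣m⇒∣n 2∣2+i ∣-refl)))

positiveEvens : ∀ n → Subset n
positiveEvens zero    = []
positiveEvens (suc n) = outside ∷ alternate outside n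

∈positiveEvens : (i : Fin n) → i ∈ positiveEvens n ⇔ (toℕ i ≢ 0 × 2 ∣ toℕ i)
∈positiveEvens zero    = mk⇔ (λ ()) (λ (0≢0 , _) → contradiction refl 0≢0)
∈positiveEvens (suc i) =
  mk⇔ (λ { (there i∈) → (λ ()) , to (∈alternate-outside i) i∈ })
      (λ (_ , 2∣1+i) → there (from (∈alternate-outside i) 2∣1+i))

∣alternate-inside[2*m]∣≡m : ∀ m → card (alternate inside (2 *ℕ m)) ≡ m
∣alternate-inside[2*m]∣≡m zero    = refl
-- The rewrite exposes the second successor of `2 *ℕ suc m`, so that `alternate` unfolds through a
-- whole period.
∣alternate-inside[2*m]∣≡m (suc m) rewrite ℕₚ.+-suc m (m ℕ.+ 0) =
  cong suc (∣alternate-inside[2*m]∣≡m m)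

-- Positions 0 and 1 contribute nothing, and what follows them alternates again from an even
-- position.
∣positiveEvens[2*m]∣≡m-1 : ∀ m → card (positiveEvens (2 *ℕ m)) ≡ m ∸ 1
∣positiveEvens[2*m]∣≡m-1 zero    = refl
∣positiveEvens[2*m]∣≡m-1 (suc m) rewrite ℕₚ.+-suc m (m ℕ.+ 0) = ∣alternate-inside[2*m]∣≡m m

∈tabulate⇔ : {P : Fin n → Set} (P? : Unary.Decidable P) (i : Fin n) →
  i ∈ Vec.tabulate (does ∘ P?) ⇔ P i
∈tabulate⇔ {P = P} P? i = mk⇔
  (λ i∈ → does⇒ (P? i) (trans (sym (lookup∘tabulate (does ∘ P?) i)) ([]=⇒lookup i∈)))
  (λ Pi → lookup⇒[]= i _ (trans (lookup∘tabulate (does ∘ P?) i) (dec-true (P? i) Pi)))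
  where
  does⇒ : (P?i : Dec (P i)) → does P?i ≡ inside → P i
  does⇒ (yes Pi) _ = Pi

isZero-·⇔ : (a b : Fin n) → IsZero (a · b) ⇔ n ∣ toℕ a *ℕ toℕ b
isZero-·⇔ {n} a b = mk⇔
  (λ ab≡0 → m%n≡0⇒n∣m _ n (trans (sym (toℕ-fromℕ< _)) ab≡0))
  (λ n∣ab → trans (toℕ-fromℕ< _) (n∣m⇒m%n≡0 _ n n∣ab))
  where instance _ = nonZeroIndex a

-- Divisibility and zero-divisors modulo twice an odd prime.

module _ (p : ℕ) (p-prime : Prime p) (2<p : 2 < p) where

  private instance
    p≢0 : ℕ.NonZero p
    p≢0 = prime⇒nonZero p-prime

  2∤p : 2 ∤ p
  2∤p 2∣p with prime⇒irreducible p-prime 2∣p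
  ... | inj₁ ()
  ... | inj₂ refl = ℕₚ.<-irrefl refl 2<p

  -- With `k = q * p`, Euclid's lemma for the prime 2 puts the factor 2 into `q`, since `p` is odd.
  2∣∧p∣⇒2p∣ : ∀ {k} → 2 ∣ k → p ∣ k → 2 *ℕ p ∣ k
  2∣∧p∣⇒2p∣ 2∣k (divides-refl q) with euclidsLemma q p prime[2] 2∣k
  ... | inj₁ 2∣q = *-monoˡ-∣ p 2∣q
  ... | inj₂ 2∣p = contradiction 2∣p 2∤p

  -- Otherwise `a` would be a nonzero multiple of `2 *ℕ p` below `2 *ℕ p`.
  ¬even∧p∣ : (a : Fin (2 *ℕ p)) → toℕ a ≢ 0 → 2 ∣ toℕ a → ¬ (p ∣ toℕ a)
  ¬even∧p∣ a a≢0 2∣a p∣a =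
    >⇒∤ {{ℕ.≢-nonZero a≢0}} (toℕ<n a) (2∣∧p∣⇒2p∣ 2∣a p∣a)

  p<2p : p < 2 *ℕ p
  -- `2 *ℕ p` unfolds to `p + (p + 0)`, hence the weakening by `0`.
  p<2p = ℕₚ.m<m+n p (ℕₚ.m≤n⇒m≤n+o 0 (ℕₚ.<-trans z<s 2<p))

  c : Fin (2 *ℕ p)
  c = fromℕ< p<2p

  -- Serves both as the annihilator that puts `c` into `V` and as the leaf required by `IsStar`.
  two : Fin (2 *ℕ p)
  two = fromℕ< (ℕₚ.<-trans 2<p p<2p)

  toℕ-c : toℕ c ≡ p
  toℕ-c = toℕ-fromℕ< p<2p

  toℕ-two : toℕ two ≡ 2
  toℕ-two = toℕ-fromℕ< (ℕₚ.<-trans 2<p p<2p)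

  c≢0 : toℕ c ≢ 0
  c≢0 = ℕ.≢-nonZero⁻¹ p ∘ trans (sym toℕ-c)

  two≢0 : toℕ two ≢ 0
  two≢0 eq with trans (sym toℕ-two) eq
  ... | ()

  -- Below `2 *ℕ p` the quotient by `p` can only be 0 or 1.
  p∣⇒≡c : (a : Fin (2 *ℕ p)) → toℕ a ≢ 0 → p ∣ toℕ a → a ≡ c
  p∣⇒≡c a a≢0 (divides zero eq) = contradiction eq a≢0
  p∣⇒≡c a a≢0 (divides 1 eq) =
    toℕ-injective (trans eq (trans (ℕₚ.*-identityˡ p) (sym toℕ-c)))
  p∣⇒≡c a a≢0 (divides (suc (suc q)) eq) = contradiction (toℕ<n a) (ℕₚ.≤⇒≯
    (subst (2 *ℕ p ≤_) (sym eq) (ℕₚ.*-monoˡ-≤ p {2} {suc (suc q)} (s≤s (s≤s z≤n)))))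

  even·c≡0 : (a : Fin (2 *ℕ p)) → 2 ∣ toℕ a → IsZero (a · c)
  even·c≡0 a 2∣a = from (isZero-·⇔ a c)
    (subst (λ k → 2 *ℕ p ∣ toℕ a *ℕ k) (sym toℕ-c) (*-monoˡ-∣ p 2∣a))

  open Graph (Γ (2 *ℕ p))

  ∈V⇔ : ∀ a → a ∈ V ⇔ IsNonzeroZeroDivisor a
  ∈V⇔ = ∈tabulate⇔ isNonzeroZeroDivisor?

  ∈V⇒≢0 : ∀ {a} → a ∈ V → toℕ a ≢ 0
  ∈V⇒≢0 {a} a∈V = proj₁ (to (∈V⇔ a) a∈V)

  -- Both 2 and `p` divide the product of `a` with its annihilator `b`. If 2 does not divide `a`, it
  -- divides `b`; then `p` cannot divide `b`, so it divides `a`, which forces `a ≡ c`.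
  ∈V∧≢c⇒even : ∀ {a} → a ∈ V → a ≢ c → 2 ∣ toℕ a
  ∈V∧≢c⇒even {a} a∈V a≢c with to (∈V⇔ a) a∈V
  ... | a≢0 , b , b≢0 , ab≡0
      with euclidsLemma (toℕ a) (toℕ b) prime[2] (∣-trans (m∣m*n p) (to (isZero-·⇔ a b) ab≡0))
         | euclidsLemma (toℕ a) (toℕ b) p-prime (∣-trans (n∣m*n 2) (to (isZero-·⇔ a b) ab≡0))
  ...   | inj₁ 2∣a | _        = 2∣a
  ...   | inj₂ _   | inj₁ p∣a = contradiction (p∣⇒≡c a a≢0 p∣a) a≢c
  ...   | inj₂ 2∣b | inj₂ p∣b = contradiction p∣b (¬even∧p∣ b b≢0 2∣b)

  positiveEven⇒∈V : ∀ {a} → toℕ a ≢ 0 → 2 ∣ toℕ a → a ∈ V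
  positiveEven⇒∈V {a} a≢0 2∣a = from (∈V⇔ a) (a≢0 , c , c≢0 , even·c≡0 a 2∣a)

  2∣two : 2 ∣ toℕ two
  2∣two = ∣-reflexive (sym toℕ-two)

  even⇒≢c : ∀ {a} → 2 ∣ toℕ a → a ≢ c
  even⇒≢c 2∣a refl = 2∤p (subst (2 ∣_) toℕ-c 2∣a)

  c∈V : c ∈ V
  c∈V = from (∈V⇔ c)
    (c≢0 , two , two≢0 , trans (cong toℕ (·-comm c two)) (even·c≡0 two 2∣two))

  Γ-isStar : IsStar (Γ (2 *ℕ p)) c
  Γ-isStar = record
    { centre∈V = c∈V
    ; leaf     = two , positiveEven⇒∈V two≢0 2∣two , even⇒≢c 2∣two
    ; leaf-adj = λ {v} v∈V v≢c → v∈V , c∈V , v≢c , even·c≡0 v (∈V∧≢c⇒even v∈V v≢c)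
    ; adj-leaf = adj-leaf
    }
    where
    -- `p` divides `u` or `v`; it cannot divide `u`, which is even and nonzero.
    adj-leaf : ∀ {u v} → u ≢ c → Adj u v → v ≡ c
    adj-leaf {u} {v} u≢c (u∈V , v∈V , _ , uv≡0)
      with euclidsLemma (toℕ u) (toℕ v) p-prime (∣-trans (n∣m*n 2) (to (isZero-·⇔ u v) uv≡0))
    ... | inj₁ p∣u = contradiction p∣u (¬even∧p∣ u (∈V⇒≢0 u∈V) (∈V∧≢c⇒even u∈V u≢c))
    ... | inj₂ p∣v = p∣⇒≡c v (∈V⇒≢0 v∈V) p∣v

  -- Trades the tabulated decision procedure behind `V` for a recursive set whose cardinality is
  -- known.
  leaves≡positiveEvens : V ∖ c ≡ positiveEvens (2 *ℕ p)
  leaves≡positiveEvens = ⊆-antisym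
    (λ {a} a∈L → from (∈positiveEvens a)
      ( ∈V⇒≢0 (p─q⊆p V ⁅ c ⁆ a∈L)
      , ∈V∧≢c⇒even (p─q⊆p V ⁅ c ⁆ a∈L) λ { refl → x∉p-x V c a∈L }))
    (λ {a} a∈E → let a≢0 , 2∣a = to (∈positiveEvens a) a∈E in
      x∈p∧x≢y⇒x∈p-y (positiveEven⇒∈V a≢0 2∣a) (even⇒≢c 2∣a))

  ∣V∣≡1+[p-1] : card V ≡ suc (p ∸ 1)
  ∣V∣≡1+[p-1] = begin
    card V                              ≡⟨ x∈p⇒∣p∣≡1+∣p-x∣ c∈V ⟩
    suc (card (V ∖ c))                  ≡⟨ cong (suc ∘ card) leaves≡positiveEvens ⟩
    suc (card (positiveEvens (2 *ℕ p))) ≡⟨ cong suc (∣positiveEvens[2*m]∣≡m-1 p) ⟩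
    suc (p ∸ 1)                         ∎

theorem3p2 : ∀ (p : ℕ) → Prime p → 2 < p →
    (D (Γ (2 *ℕ p)) ≈ x ^ (p ∸ 1) + x * (1# + x) ^ (p ∸ 1)) ×
    (Dₜ (Γ (2 *ℕ p)) ≈ x * ((1# + x) ^ (p ∸ 1) - 1#))
theorem3p2 p p-prime 2<p =
  D-star G (c p p-prime 2<p) star ∣V∣≡ , Dₜ-star G (c p p-prime 2<p) star ∣V∣≡
  where
  G    = Γ (2 *ℕ p)
  star = Γ-isStar p p-prime 2<p
  ∣V∣≡ = ∣V∣≡1+[p-1] p p-prime 2<p
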